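{- Let $(S,K,I)$ be a split graph. If the factor graph $\Phi(S)$ is connected, then its diameter is at most $\lceil(\deg(S)+1)/2\rceil$.
   Context: A split graph $(S,K,I)$ is a graph $S$ together with a fixed partition $V(S)=K\dot\cup I$, where $K$ is a clique and $I$ is an independent set. For a vertex $v$ of $S$, $N_v$ denotes its open neighborhood in $S$ and $d_v=|N_v|$; $\eta_{uv}=|N_u\cap N_v|$. A 2-switch in $S$ replaces edges $ab,cd$ with $ac,bd$ when $ab,cd\in E(S)$ and $ac,bd\notin E(S)$. The factor graph $\Phi(S)$ is the loopless multigraph with vertex set $I$ in which, for distinct $u,v\in I$, there is one edge joining $u$ and $v$ for each 2-switch of $S$ acting on $u$ and $v$; equivalently, the multiplicity of $uv$ is $\sigma_{uv}=(d_u-\eta_{uv})(d_v-\eta_{uv})$. The 2-switch-degree $\deg(S)$ is the number of 2-switches acting on $S$, which equals the number of edges of $\Phi(S)$ counted with multiplicity, i.e. $\sum_{\{u,v\}\subseteq I}\sigma_{uv}$. Distances (and hence the diameter) in $\Phi(S)$ are measured ignoring edge multiplicities, i.e. as in the underlying simple graph. -}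

module Defs where

open import Data.Fin using (Fin; _<_; _<?_; _≟_)
open import Data.Fin.Subset using (Subset; _∈_; ∁)
open import Data.List using (List; filter; length; allFin; cartesianProduct)
open import Data.List.Properties using (filter-≐; filter-none)
open import Data.List.Relation.Unary.All using (universal)
open import Data.Nat using (ℕ; suc; _≤_; NonZero)
open import Data.Product using (Σ; ∃-syntax; _×_; _,_; proj₁)
open import Data.Sum using (_⊎_)
open import Function using (_∘_)
open import Level using (0ℓ)
open import Relation.Binary using (Rel; Decidable; Symmetric)
open import Relation.Binary.PropositionalEquality using (_≡_; _≢_; refl; sym; cong)
open import Relation.Nullary using (¬_; Dec; ¬?; _×-dec_; _⊎-dec_)

record SimpleGraph (n : ℕ) : Set₁ where
  field
    _~_       : Rel (Fin n) 0ℓ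
    _~?_      : Decidable _~_
    ~-sym     : Symmetric _~_
    ~-irrefl  : ∀ v → ¬ (v ~ v)

record SplitGraph (n : ℕ) : Set₁ where
  field
    graph : SimpleGraph n
    K     : Subset n
  open SimpleGraph graph public

  I : Subset n
  I = ∁ K

  field
    K-clique      : ∀ {u v} → u ∈ K → v ∈ K → u ≢ v → u ~ v
    I-independent : ∀ {u v} → u ∈ I → v ∈ I → ¬ (u ~ v)

Quadruple : ℕ → Set
Quadruple n = Fin n × Fin n × Fin n × Fin n

quadruples : ∀ n → List (Quadruple n)
quadruples n = cartesianProduct (allFin n) (cartesianProduct (allFin n) (cartesianProduct (allFin n) (allFin n)))

module _ {n : ℕ} (G : SimpleGraph n) where
  open SimpleGraph G

  -- (a , b , c , d) encodes the replacement of the edges ab, cd by the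
  -- non-edges ac, bd.  The remaining distinctness conditions a ≢ b, c ≢ d,
  -- a ≢ d, b ≢ c follow from the ones stated.
  IsTwoSwitch : Quadruple n → Set
  IsTwoSwitch (a , b , c , d) =
    (a ~ b) × (c ~ d) × (a ≢ c) × (b ≢ d) × ¬ (a ~ c) × ¬ (b ~ d)

  isTwoSwitch? : ∀ q → Dec (IsTwoSwitch q)
  isTwoSwitch? (a , b , c , d) =
    (a ~? b) ×-dec (c ~? d) ×-dec ¬? (a ≟ c) ×-dec ¬? (b ≟ d)
      ×-dec ¬? (a ~? c) ×-dec ¬? (b ~? d)

-- The quadruples (a,b,c,d), (b,a,d,c), (c,d,a,b), (d,c,b,a), and no others,
-- encode the same 2-switch.  Exactly one of the four has its least vertex in
-- first position; it is taken as the representative.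
IsCanonical : ∀ {n} → Quadruple n → Set
IsCanonical (a , b , c , d) = (a < b) × (a < c) × (a < d)

isCanonical? : ∀ {n} (q : Quadruple n) → Dec (IsCanonical q)
isCanonical? (a , b , c , d) = (a <? b) ×-dec (a <? c) ×-dec (a <? d)

twoSwitches : ∀ {n} → SimpleGraph n → List (Quadruple n)
twoSwitches {n} G =
  filter (λ q → isTwoSwitch? G q ×-dec isCanonical? q) (quadruples n)

deg : ∀ {n} → SplitGraph n → ℕ
deg S = length (twoSwitches (SplitGraph.graph S))

Involves : ∀ {n} → Fin n → Quadruple n → Set
Involves v (a , b , c , d) = (v ≡ a) ⊎ (v ≡ b) ⊎ (v ≡ c) ⊎ (v ≡ d)

involves? : ∀ {n} (v : Fin n) (q : Quadruple n) → Dec (Involves v q)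
involves? v (a , b , c , d) = (v ≟ a) ⊎-dec (v ≟ b) ⊎-dec (v ≟ c) ⊎-dec (v ≟ d)

ActsOn : ∀ {n} → Fin n → Fin n → Quadruple n → Set
ActsOn u v q = (u ≢ v) × Involves u q × Involves v q

actsOn? : ∀ {n} (u v : Fin n) (q : Quadruple n) → Dec (ActsOn u v q)
actsOn? u v q = ¬? (u ≟ v) ×-dec involves? u q ×-dec involves? v q

record Multigraph : Set₁ where
  field
    Vertex        : Set
    multiplicity  : Vertex → Vertex → ℕ
    symmetric     : ∀ u v → multiplicity u v ≡ multiplicity v u
    loopless      : ∀ v → multiplicity v v ≡ 0

Φ : ∀ {n} → SplitGraph n → Multigraph
Φ {n} S = record
  { Vertex       = Σ (Fin n) (_∈ I)
  ; multiplicity = λ (u , _) (v , _) → length (filter (actsOn? u v) switches)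
  ; symmetric    = λ (u , _) (v , _) → cong length
                     (filter-≐ (actsOn? u v) (actsOn? v u) (flip , flip) switches)
  ; loopless     = λ (v , _) → cong length
                     (filter-none (actsOn? v v)
                       (universal (λ _ acts → proj₁ acts refl) switches))
  }
  where
  open SplitGraph S
  switches : List (Quadruple n)
  switches = twoSwitches graph
  flip : ∀ {u v : Fin n} {q} → ActsOn u v q → ActsOn v u q
  flip (u≢v , iu , iv) = u≢v ∘ sym , iv , iu

module _ (G : Multigraph) where
  open Multigraph G

  data Walk : Vertex → Vertex → ℕ → Set where
    stop : ∀ {u} → Walk u u 0
    step : ∀ {u v w k} → NonZero (multiplicity u v) → Walk v w k → Walk u w (suc k)

  Connected : Set
  Connected = ∀ u v → ∃[ k ] Walk u v k

  IsDistance : Vertex → Vertex → ℕ → Set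
  IsDistance u v d = Walk u v d × (∀ k → Walk u v k → d ≤ k)

  BoundsDistances : ℕ → Set
  BoundsDistances D = ∀ u v → ∃[ d ] (IsDistance u v d × d ≤ D)

  -- The diameter as the supremum in ℕ of all distances: the maximum distance
  -- when there is a vertex, and 0 for the graph without vertices.  A
  -- disconnected graph has no diameter in this sense.
  IsDiameter : ℕ → Set
  IsDiameter D = BoundsDistances D × (∀ D′ → BoundsDistances D′ → D ≤ D′)

{-# OPTIONS --safe #-}

-- Two vertices u, v of I are adjacent in Φ(S) exactly when N_u and N_v are
-- incomparable under inclusion, and a 2-switch acts on exactly one pair of
-- vertices of I, so deg(S) is at least the total multiplicity along a shortest
-- walk of length k.  An inner edge bc of such a walk a b c d has multiplicity
-- at least 2: if N_b ∖ N_c = {x} and N_c ∖ N_b = {y}, then comparability of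
-- a, c and of b, d forces y ∈ N_a ∖ N_d and x ∈ N_d ∖ N_a, making a and d
-- adjacent.  Hence deg(S) ≥ 1 + 2(k − 2) + 1 = 2k − 2.
module Submission where

open import Defs
open import Data.Nat using (ℕ; _+_; _≤_; ⌈_/2⌉)
open import Data.Product using (∃-syntax; _×_)

open import Data.Fin as Fin using (Fin)
open import Data.Fin.Properties as Finₚ using (any?)
open import Data.Fin.Subset using (Subset) renaming (_∈_ to _∈ₛ_)
open import Data.Fin.Subset.Properties using (x∉p⇒x∈∁p; x∈∁p⇒x∉p; _∈?_)
open import Data.List using (List; []; _∷_; filter; length)
open import Data.List.Membership.Propositional using (_∈_)
open import Data.List.Membership.Propositional.Properties using (∈-filter⁺; ∈-filter⁻; ∈-allFin; ∈-cartesianProduct⁺)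
open import Data.List.Properties using (length-filter)
open import Data.List.Relation.Unary.Any using (here; there)
open import Data.Nat using (zero; suc; ⌊_/2⌋; _∸_; _<_; z≤n; s≤s; NonZero; >-nonZero; >-nonZero⁻¹; _≤?_)
open import Data.Nat.Properties using (≤-refl; ≤-trans; ≤-reflexive; <⇒≱; n<1+n; m≤n⇒m≤1+n; +-identityʳ; +-comm; +-suc; +-assoc; +-mono-≤; +-cancelʳ-≤; m+[n∸m]≡n; m≤n+m; ⌈n/2⌉-mono; ⌊n/2⌋-mono; n≡⌊n+n/2⌋; nonZero?; module ≤-Reasoning)
open import Data.Product using (Σ; _,_; proj₁; proj₂)
open import Data.Sum using (_⊎_; inj₁; inj₂)
open import Data.Vec.Properties.WithK using ([]=-irrelevant)
open import Function using (_∘_; id)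
open import Level using (0ℓ)
open import Relation.Binary using (tri<; tri≈; tri>)
open import Relation.Binary.PropositionalEquality using (_≡_; _≢_; refl; sym; cong; subst; ≢-sym)
open import Relation.Nullary using (¬_; Dec; yes; no; ¬?; _×-dec_; contradiction)
open import Relation.Nullary.Decidable using (map′; decidable-stable)
open import Relation.Unary using (Pred; Decidable; _∪_)
open import Relation.Unary.Properties using (_∪?_)

-- Least natural numbers and counting in filtered lists.

least : ∀ {P : Pred ℕ 0ℓ} → Decidable P → ∀ {k} → P k →
        ∃[ m ] (P m × m ≤ k × (∀ j → P j → m ≤ j))
least P? {k} pk with P? 0
least P? {k}     pk | yes p0 = 0 , p0 , z≤n , λ _ _ → z≤n
least P? {zero}  pk | no ¬p0 = contradiction pk ¬p0
least {P} P? {suc k} pk | no ¬p0 =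
  let m , pm , m≤k , min = least {P ∘ suc} (P? ∘ suc) pk in
  suc m , pm , s≤s m≤k , λ { zero p0 → contradiction p0 ¬p0 ; (suc j) pj → s≤s (min j pj) }

module _ {A : Set} where

  1≤length : ∀ {x : A} {xs} → x ∈ xs → 1 ≤ length xs
  1≤length (here _)  = s≤s z≤n
  1≤length (there _) = s≤s z≤n

  2≤length : ∀ {x y : A} {xs} → x ∈ xs → y ∈ xs → x ≢ y → 2 ≤ length xs
  2≤length (here refl) (here refl) x≢y = contradiction refl x≢y
  2≤length (here _)    (there y∈)  _   = s≤s (1≤length y∈)
  2≤length (there x∈)  _           _   = s≤s (1≤length x∈)

  nonempty : ∀ {xs : List A} → NonZero (length xs) → ∃[ x ] x ∈ xs
  nonempty {x ∷ _} _ = x , here refl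

  length-filter-disjoint : ∀ {P Q : Pred A 0ℓ} (P? : Decidable P) (Q? : Decidable Q) xs →
    (∀ {x} → x ∈ xs → P x → ¬ Q x) →
    length (filter P? xs) + length (filter Q? xs) ≤ length (filter (P? ∪? Q?) xs)
  length-filter-disjoint P? Q? [] _ = z≤n
  length-filter-disjoint P? Q? (x ∷ xs) disjoint
    with ih ← length-filter-disjoint P? Q? xs (disjoint ∘ there) | P? x | Q? x
  ... | yes px | yes qx = contradiction qx (disjoint (here refl) px)
  ... | yes _  | no _   = s≤s ih
  ... | no _   | yes _  = ≤-trans (≤-reflexive (+-suc _ _)) (s≤s ih)
  ... | no _   | no _   = ih

  -- `P i` stands for the switches on the i-th edge of a walk of length `2 + m`. The disjoint
  -- classes are joined one at a time: the first and the last contribute 1, the m inner ones 2 each,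
  -- in total 1 + 2m + 1.
  length-lower-bound : ∀ {P : ℕ → Pred A 0ℓ} (P? : ∀ i → Decidable (P i)) xs m →
    (∀ {i j x} → i < j → j < 2 + m → x ∈ xs → P i x → ¬ P j x) →
    (∀ {i} → i < 2 + m → 1 ≤ length (filter (P? i) xs)) →
    (∀ {i} → i < m → 2 ≤ length (filter (P? (suc i)) xs)) →
    suc m + suc m ≤ length xs
  length-lower-bound {P} P? xs m disjoint ends inner = begin
    suc m + suc m                                                  ≡⟨ cong suc (+-suc m m) ⟩
    2 + (m + m)                                                    ≡⟨ +-comm 1 (suc (m + m)) ⟩
    suc (m + m) + 1                                                ≤⟨ +-mono-≤ (partial m ≤-refl) (ends (n<1+n _)) ⟩
    length (filter (U? m) xs) + length (filter (P? (suc m)) xs)    ≤⟨ extend m (n<1+n _) ⟩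
    length (filter (U? (suc m)) xs)                                ≤⟨ length-filter (U? (suc m)) xs ⟩
    length xs                                                      ∎
    where
    open ≤-Reasoning

    U : ℕ → Pred A 0ℓ
    U zero    = P 0
    U (suc i) = U i ∪ P (suc i)

    U? : ∀ i → Decidable (U i)
    U? zero    = P? 0
    U? (suc i) = U? i ∪? P? (suc i)

    U⇒P : ∀ i {x} → U i x → ∃[ j ] (j < suc i × P j x)
    U⇒P zero    p        = 0 , s≤s z≤n , p
    U⇒P (suc i) (inj₁ u) = let j , j<1+i , p = U⇒P i u in j , m≤n⇒m≤1+n j<1+i , p
    U⇒P (suc i) (inj₂ p) = suc i , n<1+n _ , p

    extend : ∀ i → suc i < 2 + m →
      length (filter (U? i) xs) + length (filter (P? (suc i)) xs) ≤ length (filter (U? (suc i)) xs)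
    extend i i<m = length-filter-disjoint (U? i) (P? (suc i)) xs λ x∈ u →
      let j , j<1+i , p = U⇒P i u in disjoint j<1+i i<m x∈ p

    partial : ∀ i → i ≤ m → suc (i + i) ≤ length (filter (U? i) xs)
    partial zero    _   = ends (s≤s z≤n)
    partial (suc i) i<m = begin
      suc (suc i + suc i)                                         ≡⟨ cong (2 +_) (+-suc i i) ⟩
      2 + suc (i + i)                                             ≡⟨ +-comm 2 (suc (i + i)) ⟩
      suc (i + i) + 2                                             ≤⟨ +-mono-≤ (partial i (≤-trans (m≤n+m i 1) i<m)) (inner i<m) ⟩
      length (filter (U? i) xs) + length (filter (P? (suc i)) xs) ≤⟨ extend i (s≤s (m≤n⇒m≤1+n i<m)) ⟩
      length (filter (U? (suc i)) xs)                             ∎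

-- Decidable quantifiers over the elements of a subset.

module _ {n : ℕ} (p : Subset n) where

  element-≡ : {u v : Σ (Fin n) (_∈ₛ p)} → proj₁ u ≡ proj₁ v → u ≡ v
  element-≡ {u , u∈p} {_ , v∈p} refl = cong (u ,_) ([]=-irrelevant u∈p v∈p)

  anyElement? : ∀ {P : Pred (Σ (Fin n) (_∈ₛ p)) 0ℓ} → Decidable P → Dec (Σ _ P)
  anyElement? {P} P? = map′ (λ (i , i∈p , px) → (i , i∈p) , px) (λ ((i , i∈p) , px) → i , i∈p , px) (any? at?)
    where
    at? : ∀ i → Dec (Σ (i ∈ₛ p) λ i∈p → P (i , i∈p))
    at? i with i ∈? p
    ... | no i∉p  = no (i∉p ∘ proj₁)
    -- `px` may refer to another proof of membership than `i∈p`; irrelevance of such proofs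
    -- transports it.
    ... | yes i∈p = map′ (i∈p ,_) (λ (_ , px) → subst P (element-≡ refl) px) (P? (i , i∈p))

  allElements? : ∀ {P : Pred (Σ (Fin n) (_∈ₛ p)) 0ℓ} → Decidable P → Dec (∀ v → P v)
  allElements? {P} P? with anyElement? (λ v → ¬? (P? v))
  ... | yes (v , ¬pv) = no λ all → ¬pv (all v)
  ... | no ¬∃         = yes λ v → decidable-stable (P? v) λ ¬pv → ¬∃ (v , ¬pv)

-- Walks and shortest walks.

module _ {G : Multigraph} where
  open Multigraph G

  private variable
    u v w : Vertex
    j k   : ℕ

  _◅◅_ : Walk G u v j → Walk G v w k → Walk G u w (j + k)
  stop     ◅◅ W = W
  step e V ◅◅ W = step e (V ◅◅ W)

  -- Constantly the last vertex from position k on.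
  vertexAt : Walk G u w k → ℕ → Vertex
  vertexAt {u} W          zero    = u
  vertexAt {u} stop       (suc i) = u
  vertexAt     (step _ W) (suc i) = vertexAt W i

  edgeAt : (W : Walk G u w k) → ∀ {i} → i < k →
           NonZero (multiplicity (vertexAt W i) (vertexAt W (suc i)))
  edgeAt (step e W) {zero}  _         = e
  edgeAt (step e W) {suc i} (s≤s i<k) = edgeAt W i<k

  takeWalk : (W : Walk G u w k) → ∀ {i} → i ≤ k → Walk G u (vertexAt W i) i
  takeWalk W          {zero}  _         = stop
  takeWalk (step e W) {suc i} (s≤s i≤k) = step e (takeWalk W i≤k)

  dropWalk : (W : Walk G u w k) → ∀ {i} → i ≤ k → Walk G (vertexAt W i) w (k ∸ i)
  dropWalk W          {zero}  _         = W
  dropWalk (step e W) {suc i} (s≤s i≤k) = dropWalk W i≤k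

  -- Replacing the stretch of `W` from i to j by `V` gives a walk of length i + l + (k ∸ j), which
  -- is at least k by minimality. With l = 0 this excludes repeated vertices, with l = 1 shortcuts.
  geodesic : (W : Walk G u w k) → (∀ l → Walk G u w l → k ≤ l) →
             ∀ {i j l} → i ≤ j → j ≤ k → Walk G (vertexAt W i) (vertexAt W j) l → j ≤ i + l
  geodesic {k = k} W min {i} {j} {l} i≤j j≤k V = +-cancelʳ-≤ (k ∸ j) j (i + l) (begin
    j + (k ∸ j)       ≡⟨ m+[n∸m]≡n j≤k ⟩
    k                 ≤⟨ min _ (takeWalk W (≤-trans i≤j j≤k) ◅◅ (V ◅◅ dropWalk W j≤k)) ⟩
    i + (l + (k ∸ j)) ≡⟨ +-assoc i l (k ∸ j) ⟨
    i + l + (k ∸ j)   ∎)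
    where open ≤-Reasoning

-- The vertices of a 2-switch inside the independent set.

module _ {n : ℕ} (S : SplitGraph n) where
  open SplitGraph S
  open Multigraph (Φ S) using (Vertex; multiplicity)

  switches : List (Quadruple n)
  switches = twoSwitches graph

  Incomparable : Fin n → Fin n → Set
  Incomparable u v = ∃[ x ] ∃[ y ] (x ~ u × ¬ (x ~ v) × y ~ v × ¬ (y ~ u))

  incomparable-sym : ∀ {u v} → Incomparable u v → Incomparable v u
  incomparable-sym (x , y , xu , ¬xv , yv , ¬yu) = y , x , yv , ¬yu , xu , ¬xv

  ~I⇒∈K : ∀ {u x} → u ∈ₛ I → x ~ u → x ∈ₛ K
  ~I⇒∈K {x = x} u∈I xu = decidable-stable (x ∈? K) λ x∉K → I-independent (x∉p⇒x∈∁p x∉K) u∈I xu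

  K∩I≡∅ : ∀ {u v} → u ∈ₛ K → v ∈ₛ I → v ≢ u
  K∩I≡∅ u∈K v∈I refl = x∈∁p⇒x∉p v∈I u∈K

  -- The edges ab, cd and the non-edges ac, bd form a 4-cycle. No edge lies within I and no non-edge
  -- within K, so K and I alternate around it: the vertices in I are b, c if a ∈ K, and a, d
  -- otherwise.
  switch-ends : ∀ {q} → IsTwoSwitch graph q →
    ∃[ p ] ∃[ r ] (Incomparable p r × (∀ {w} → w ∈ₛ I → Involves w q → w ≡ p ⊎ w ≡ r))
  switch-ends {a , b , c , d} (ab , cd , a≢c , b≢d , ¬ac , ¬bd) with a ∈? K
  ... | yes a∈K = b , c , (a , d , ab , ¬ac , ~-sym cd , ¬bd ∘ ~-sym) , ends
    where
    c∈I : c ∈ₛ I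
    c∈I = x∉p⇒x∈∁p λ c∈K → ¬ac (K-clique a∈K c∈K a≢c)
    ends : ∀ {w} → w ∈ₛ I → Involves w (a , b , c , d) → w ≡ b ⊎ w ≡ c
    ends w∈I (inj₁ w≡a)               = contradiction w≡a (K∩I≡∅ a∈K w∈I)
    ends w∈I (inj₂ (inj₁ w≡b))        = inj₁ w≡b
    ends w∈I (inj₂ (inj₂ (inj₁ w≡c))) = inj₂ w≡c
    ends w∈I (inj₂ (inj₂ (inj₂ w≡d))) = contradiction w≡d (K∩I≡∅ (~I⇒∈K c∈I (~-sym cd)) w∈I)
  ... | no a∉K = a , d , (b , c , ~-sym ab , ¬bd , cd , ¬ac ∘ ~-sym) , ends
    where
    b∈K : b ∈ₛ K
    b∈K = ~I⇒∈K (x∉p⇒x∈∁p a∉K) (~-sym ab)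
    d∈I : d ∈ₛ I
    d∈I = x∉p⇒x∈∁p λ d∈K → ¬bd (K-clique b∈K d∈K b≢d)
    ends : ∀ {w} → w ∈ₛ I → Involves w (a , b , c , d) → w ≡ a ⊎ w ≡ d
    ends w∈I (inj₁ w≡a)               = inj₁ w≡a
    ends w∈I (inj₂ (inj₁ w≡b))        = contradiction w≡b (K∩I≡∅ b∈K w∈I)
    ends w∈I (inj₂ (inj₂ (inj₁ w≡c))) = contradiction w≡c (K∩I≡∅ (~I⇒∈K d∈I cd) w∈I)
    ends w∈I (inj₂ (inj₂ (inj₂ w≡d))) = inj₂ w≡d

  actsOn⇒incomparable : ∀ {q u v} → IsTwoSwitch graph q → u ∈ₛ I → v ∈ₛ I →
                        ActsOn u v q → Incomparable u v
  actsOn⇒incomparable sw u∈I v∈I (u≢v , iu , iv) with switch-ends sw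
  ... | p , r , inc , ends with ends u∈I iu | ends v∈I iv
  ... | inj₁ refl | inj₁ refl = contradiction refl u≢v
  ... | inj₁ refl | inj₂ refl = inc
  ... | inj₂ refl | inj₁ refl = incomparable-sym inc
  ... | inj₂ refl | inj₂ refl = contradiction refl u≢v

  -- Pigeonhole on the two ends from `switch-ends`. This keeps a switch from being counted on two
  -- edges of a walk.
  ¬three-involved : ∀ {q u v w} → IsTwoSwitch graph q → u ∈ₛ I → v ∈ₛ I → w ∈ₛ I →
    u ≢ v → u ≢ w → v ≢ w → Involves u q → Involves v q → ¬ Involves w q
  ¬three-involved sw u∈I v∈I w∈I u≢v u≢w v≢w iu iv iw with switch-ends sw
  ... | p , r , _ , ends with ends u∈I iu | ends v∈I iv | ends w∈I iw
  ... | inj₁ refl | inj₁ refl | _         = u≢v refl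
  ... | inj₁ refl | inj₂ refl | inj₁ refl = u≢w refl
  ... | inj₁ refl | inj₂ refl | inj₂ refl = v≢w refl
  ... | inj₂ refl | inj₁ refl | inj₁ refl = v≢w refl
  ... | inj₂ refl | inj₁ refl | inj₂ refl = u≢w refl
  ... | inj₂ refl | inj₂ refl | _         = u≢v refl

  -- Canonical representatives of 2-switches.

  ∈switches⁺ : ∀ {q} → IsTwoSwitch graph q → IsCanonical q → q ∈ switches
  ∈switches⁺ sw can = ∈-filter⁺ (λ q → isTwoSwitch? graph q ×-dec isCanonical? q)
    (∈-cartesianProduct⁺ (∈-allFin _) (∈-cartesianProduct⁺ (∈-allFin _) (∈-cartesianProduct⁺ (∈-allFin _) (∈-allFin _))))
    (sw , can)

  ∈switches⁻ : ∀ {q} → q ∈ switches → IsTwoSwitch graph q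
  ∈switches⁻ q∈ = proj₁ (proj₂ (∈-filter⁻ (λ q → isTwoSwitch? graph q ×-dec isCanonical? q) {xs = quadruples n} q∈))

  -- `ActsOn` depends only on the vertices involved, so these are what the passage to the listed
  -- representative has to preserve.
  SameVertices : Quadruple n → Quadruple n → Set
  SameVertices q q′ = ∀ {w} → (Involves w q → Involves w q′) × (Involves w q′ → Involves w q)

  Canonicalizable : Quadruple n → Set
  Canonicalizable q = ∃[ q′ ] (q′ ∈ switches × SameVertices q q′)

  rotate : ∀ {a b c d w : Fin n} → Involves w (a , b , c , d) → Involves w (c , d , a , b)
  rotate (inj₁ e)               = inj₂ (inj₂ (inj₁ e))
  rotate (inj₂ (inj₁ e))        = inj₂ (inj₂ (inj₂ e))
  rotate (inj₂ (inj₂ (inj₁ e))) = inj₁ e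
  rotate (inj₂ (inj₂ (inj₂ e))) = inj₂ (inj₁ e)

  reverse : ∀ {a b c d w : Fin n} → Involves w (a , b , c , d) → Involves w (b , a , d , c)
  reverse (inj₁ e)               = inj₂ (inj₁ e)
  reverse (inj₂ (inj₁ e))        = inj₁ e
  reverse (inj₂ (inj₂ (inj₁ e))) = inj₂ (inj₂ (inj₂ e))
  reverse (inj₂ (inj₂ (inj₂ e))) = inj₂ (inj₂ (inj₁ e))

  switch-rotate : ∀ {a b c d} → IsTwoSwitch graph (a , b , c , d) → IsTwoSwitch graph (c , d , a , b)
  switch-rotate (ab , cd , a≢c , b≢d , ¬ac , ¬bd) =
    cd , ab , ≢-sym a≢c , ≢-sym b≢d , ¬ac ∘ ~-sym , ¬bd ∘ ~-sym

  switch-reverse : ∀ {a b c d} → IsTwoSwitch graph (a , b , c , d) → IsTwoSwitch graph (b , a , d , c)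
  switch-reverse (ab , cd , a≢c , b≢d , ¬ac , ¬bd) =
    ~-sym ab , ~-sym cd , b≢d , a≢c , ¬bd , ¬ac

  canonicalizable-rotate : ∀ {a b c d} → Canonicalizable (c , d , a , b) → Canonicalizable (a , b , c , d)
  canonicalizable-rotate (q , q∈ , same) = q , q∈ , (proj₁ same ∘ rotate , rotate ∘ proj₂ same)

  canonicalizable-reverse : ∀ {a b c d} → Canonicalizable (b , a , d , c) → Canonicalizable (a , b , c , d)
  canonicalizable-reverse (q , q∈ , same) = q , q∈ , (proj₁ same ∘ reverse , reverse ∘ proj₂ same)

  switch-a≢d : ∀ {a b c d} → IsTwoSwitch graph (a , b , c , d) → a ≢ d
  switch-a≢d (ab , cd , _ , _ , ¬ac , _) refl = ¬ac (~-sym cd)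

  ~⇒≢ : ∀ {u v} → u ~ v → u ≢ v
  ~⇒≢ uv refl = ~-irrefl _ uv

  private
    canonicalize-a<bc : ∀ {a b c d} → IsTwoSwitch graph (a , b , c , d) →
      a Fin.< b → a Fin.< c → Canonicalizable (a , b , c , d)
    canonicalize-a<bc {a} {d = d} sw a<b a<c with Finₚ.<-cmp a d
    ... | tri< a<d _ _ = _ , ∈switches⁺ sw (a<b , a<c , a<d) , (id , id)
    ... | tri≈ _ a≡d _ = contradiction a≡d (switch-a≢d sw)
    ... | tri> _ _ d<a = canonicalizable-rotate (canonicalizable-reverse
      (_ , ∈switches⁺ (switch-reverse (switch-rotate sw)) (Finₚ.<-trans d<a a<c , Finₚ.<-trans d<a a<b , d<a) , (id , id)))

    canonicalize-a<b : ∀ {a b c d} → IsTwoSwitch graph (a , b , c , d) →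
      a Fin.< b → Canonicalizable (a , b , c , d)
    canonicalize-a<b {a} {b} {c} {d} sw@(_ , cd , a≢c , _) a<b with Finₚ.<-cmp a c | Finₚ.<-cmp c d
    ... | tri< a<c _ _ | _            = canonicalize-a<bc sw a<b a<c
    ... | tri≈ _ a≡c _ | _            = contradiction a≡c a≢c
    ... | tri> _ _ c<a | tri< c<d _ _ = canonicalizable-rotate (canonicalize-a<bc (switch-rotate sw) c<d c<a)
    ... | tri> _ _ c<a | tri≈ _ c≡d _ = contradiction c≡d (~⇒≢ cd)
    ... | tri> _ _ c<a | tri> _ _ d<c = canonicalizable-rotate (canonicalizable-reverse
      (canonicalize-a<bc (switch-reverse (switch-rotate sw)) d<c (Finₚ.<-trans d<c (Finₚ.<-trans c<a a<b))))

  -- A tournament for the least vertex: whenever the leading vertex loses a comparison, a rotation,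
  -- a reversal or both bring the winner to the front. Ties contradict the conditions on a 2-switch.
  canonicalize : ∀ {q} → IsTwoSwitch graph q → Canonicalizable q
  canonicalize {a , b , c , d} sw@(ab , _) with Finₚ.<-cmp a b
  ... | tri< a<b _ _ = canonicalize-a<b sw a<b
  ... | tri≈ _ a≡b _ = contradiction a≡b (~⇒≢ ab)
  ... | tri> _ _ b<a = canonicalizable-reverse (canonicalize-a<b (switch-reverse sw) b<a)

  -- Edges of the factor graph as incomparable neighbourhoods.

  multiplicity⇒incomparable : ∀ (u v : Vertex) → NonZero (multiplicity u v) → Incomparable (proj₁ u) (proj₁ v)
  multiplicity⇒incomparable (u , u∈I) (v , v∈I) nz =
    let q , q∈ = nonempty nz
        q∈switches , acts = ∈-filter⁻ (actsOn? u v) {xs = switches} q∈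
    in actsOn⇒incomparable (∈switches⁻ q∈switches) u∈I v∈I acts

  SwitchBetween : (u v x y : Fin n) → Set
  SwitchBetween u v x y = ∃[ q ] (q ∈ filter (actsOn? u v) switches × SameVertices (u , x , y , v) q)

  switchBetween : ∀ {u v x y} → u ∈ₛ I → v ∈ₛ I → x ~ u → ¬ (x ~ v) → y ~ v → ¬ (y ~ u) →
                  SwitchBetween u v x y
  switchBetween {u} {v} {x} {y} u∈I v∈I xu ¬xv yv ¬yu =
    -- The switch replaces the edges ux, yv by the non-edges uy, xv. Either of u = y and x = v would
    -- put an edge inside I.
    let q , q∈ , same = canonicalize {u , x , y , v}
          ( ~-sym xu , yv
          , (λ { refl → I-independent u∈I v∈I yv })
          , (λ { refl → I-independent v∈I u∈I xu })
          , ¬yu ∘ ~-sym , ¬xv )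
    in q , ∈-filter⁺ (actsOn? u v) q∈
             ( (λ { refl → ¬xv xu })
             , proj₁ same (inj₁ refl)
             , proj₁ same (inj₂ (inj₂ (inj₂ refl))) ) , same

  incomparable⇒multiplicity : ∀ (u v : Vertex) → Incomparable (proj₁ u) (proj₁ v) → NonZero (multiplicity u v)
  incomparable⇒multiplicity (u , u∈I) (v , v∈I) (x , y , xu , ¬xv , yv , ¬yu) =
    let _ , q∈ , _ = switchBetween u∈I v∈I xu ¬xv yv ¬yu in >-nonZero (1≤length q∈)

  -- The two switches differ because only one of them involves x.
  two-private-neighbours : ∀ {u v x x′ y} → u ∈ₛ I → v ∈ₛ I → x ≢ x′ →
    x ~ u → ¬ (x ~ v) → x′ ~ u → ¬ (x′ ~ v) → y ~ v → ¬ (y ~ u) →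
    2 ≤ length (filter (actsOn? u v) switches)
  two-private-neighbours {u} {v} {x} {x′} {y} u∈I v∈I x≢x′ xu ¬xv x′u ¬x′v yv ¬yu
    with switchBetween u∈I v∈I xu ¬xv yv ¬yu | switchBetween u∈I v∈I x′u ¬x′v yv ¬yu
  ... | q , q∈ , same | q′ , q′∈ , same′ = 2≤length q∈ q′∈ λ { refl → x-not-involved (proj₂ same′ (proj₁ same (inj₂ (inj₁ refl)))) }
    where
    x-not-involved : ¬ Involves x (u , x′ , y , v)
    x-not-involved (inj₁ x≡u)                = ~⇒≢ xu x≡u
    x-not-involved (inj₂ (inj₁ x≡x′))        = x≢x′ x≡x′
    x-not-involved (inj₂ (inj₂ (inj₁ refl))) = ¬yu xu
    x-not-involved (inj₂ (inj₂ (inj₂ refl))) = I-independent v∈I u∈I xu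

  -- Inner edges of a shortest walk.

  module _ {b c x y : Fin n}
           (x-unique : ∀ {z} → z ~ b → ¬ (z ~ c) → z ≡ x)
           (y-unique : ∀ {z} → z ~ c → ¬ (z ~ b) → z ≡ y)
           (¬xc : ¬ (x ~ c)) (yc : y ~ c) where

    -- Take p ∈ N_a ∖ N_b and r ∈ N_b ∖ N_a. If p ∈ N_c then p = y; otherwise p ∈ N_a ∖ N_c, and y ∉
    -- N_a would make a, c incomparable. If x ∈ N_a, then either r ∈ N_c and x, r make a, c
    -- incomparable, or r = x, against r ∉ N_a.
    private-neighbours-of-end : ∀ {a} → Incomparable a b → ¬ Incomparable a c → y ~ a × ¬ (x ~ a)
    private-neighbours-of-end {a} (p , r , pa , ¬pb , rb , ¬ra) ¬inc = y~a , x≁a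
      where
      y~a : y ~ a
      y~a with p ~? c
      ... | yes pc = subst (_~ a) (y-unique pc ¬pb) pa
      ... | no ¬pc = decidable-stable (y ~? a) λ ¬ya → ¬inc (p , y , pa , ¬pc , yc , ¬ya)
      x≁a : ¬ (x ~ a)
      x≁a xa with r ~? c
      ... | yes rc = ¬inc (x , r , xa , ¬xc , rc , ¬ra)
      ... | no ¬rc = ¬ra (subst (_~ a) (sym (x-unique rb ¬rc)) xa)

  inner-multiplicity : ∀ (a b c d : Vertex) →
    NonZero (multiplicity a b) → NonZero (multiplicity b c) → NonZero (multiplicity c d) →
    ¬ NonZero (multiplicity a c) → ¬ NonZero (multiplicity b d) → ¬ NonZero (multiplicity a d) →
    2 ≤ multiplicity b c
  inner-multiplicity a′@(a , _) b′@(b , b∈I) c′@(c , c∈I) d′@(d , _) ab bc cd ¬ac ¬bd ¬ad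
    with multiplicity⇒incomparable b′ c′ bc
  ... | x , y , xb , ¬xc , yc , ¬yb
    -- A second element of N_b ∖ N_c or of N_c ∖ N_b yields two switches at once; a and d enter only
    -- when both differences are singletons.
    with any? (λ z → (z ~? b) ×-dec ¬? (z ~? c) ×-dec ¬? (x Fin.≟ z))
       | any? (λ z → (z ~? c) ×-dec ¬? (z ~? b) ×-dec ¬? (y Fin.≟ z))
  ... | yes (z , zb , ¬zc , x≢z) | _ = two-private-neighbours b∈I c∈I x≢z xb ¬xc zb ¬zc yc ¬yb
  ... | no _ | yes (z , zc , ¬zb , y≢z) =
    subst (2 ≤_) (Multigraph.symmetric (Φ S) c′ b′) (two-private-neighbours c∈I b∈I y≢z yc ¬yb zc ¬zb xb ¬xc)
  ... | no ¬∃x | no ¬∃y =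
    let ya , ¬xa = private-neighbours-of-end x-unique y-unique ¬xc yc
                     (multiplicity⇒incomparable a′ b′ ab) (¬ac ∘ incomparable⇒multiplicity a′ c′)
        -- The same argument from the other end: d replaces a, with b, c and x, y exchanged.
        xd , ¬yd = private-neighbours-of-end y-unique x-unique ¬yb xb
                     (incomparable-sym (multiplicity⇒incomparable c′ d′ cd))
                     (¬bd ∘ incomparable⇒multiplicity b′ d′ ∘ incomparable-sym)
    in contradiction (incomparable⇒multiplicity a′ d′ (y , x , ya , ¬yd , xd , ¬xa)) ¬ad
    where
    x-unique : ∀ {z} → z ~ b → ¬ (z ~ c) → z ≡ x
    x-unique {z} zb ¬zc = sym (decidable-stable (x Fin.≟ z) λ x≢z → ¬∃x (z , zb , ¬zc , x≢z))
    y-unique : ∀ {z} → z ~ c → ¬ (z ~ b) → z ≡ y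
    y-unique {z} zc ¬zb = sym (decidable-stable (y Fin.≟ z) λ y≢z → ¬∃y (z , zc , ¬zb , y≢z))

  -- Bounding the length of a shortest walk.

  geodesic-length : ∀ {u w k} → IsDistance (Φ S) u w k → k ≤ ⌈ deg S + 1 /2⌉
  geodesic-length {k = zero}  _ = z≤n
  geodesic-length {k = suc zero} _ = ⌈n/2⌉-mono (m≤n+m 1 (deg S))
  geodesic-length {k = suc (suc m)} (W , min) = begin
    suc (suc m)                  ≡⟨ cong suc (n≡⌊n+n/2⌋ (suc m)) ⟩
    -- `⌈ 1 + deg S /2⌉` unfolds to `suc ⌊ deg S /2⌋`, so it suffices to halve `count`.
    suc ⌊ suc m + suc m /2⌋      ≤⟨ s≤s (⌊n/2⌋-mono count) ⟩
    ⌈ 1 + deg S /2⌉              ≡⟨ cong ⌈_/2⌉ (+-comm 1 (deg S)) ⟩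
    ⌈ deg S + 1 /2⌉              ∎
    where
    open ≤-Reasoning hiding (stop)

    f : ℕ → Vertex
    f = vertexAt W

    far-apart : ∀ {i j} → suc i < j → j ≤ 2 + m → ¬ NonZero (multiplicity (f i) (f j))
    far-apart {i} {j} i+1<j j≤k e = <⇒≱ i+1<j
      (subst (j ≤_) (+-comm i 1) (geodesic W min (≤-trans (m≤n+m i 2) i+1<j) j≤k (step e stop)))

    distinct : ∀ {i j} → i < j → j ≤ 2 + m → proj₁ (f i) ≢ proj₁ (f j)
    distinct {i} {j} i<j j≤k eq = <⇒≱ i<j
      (subst (j ≤_) (+-identityʳ i) (geodesic W min (≤-trans (m≤n+m i 1) i<j) j≤k
        (subst (λ v → Walk (Φ S) (f i) v 0) (element-≡ I eq) stop)))

    count : suc m + suc m ≤ deg S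
    count = length-lower-bound (λ i → actsOn? (proj₁ (f i)) (proj₁ (f (suc i)))) switches m
      -- A switch in both classes i < j would involve f i, f (1 + i) and f (1 + j). The third is not
      -- f j, which is f (1 + i) when j = 1 + i.
      (λ {i} {j} i<j j<k q∈ (u≢v , iu , iv) (_ , _ , iw) →
        ¬three-involved (∈switches⁻ q∈) (proj₂ (f i)) (proj₂ (f (suc i))) (proj₂ (f (suc j)))
          u≢v (distinct (m≤n⇒m≤1+n i<j) j<k) (distinct (s≤s i<j) j<k) iu iv iw)
      (λ i<k → >-nonZero⁻¹ _ {{edgeAt W i<k}})
      -- Class `suc i` belongs to the edge from f (1 + i) to f (2 + i); as i < m, the walk also has
      -- the edges before and after it.
      (λ {i} i<m → let i+3≤k = s≤s (s≤s i<m) in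
        inner-multiplicity (f i) (f (1 + i)) (f (2 + i)) (f (3 + i))
          (edgeAt W (≤-trans (m≤n+m _ 2) i+3≤k)) (edgeAt W (≤-trans (m≤n+m _ 1) i+3≤k)) (edgeAt W i+3≤k)
          (far-apart ≤-refl (≤-trans (m≤n+m _ 1) i+3≤k)) (far-apart ≤-refl i+3≤k)
          (far-apart (m≤n+m _ 1) i+3≤k))

  -- Decidability of distances and the diameter.

  walk? : ∀ u w k → Dec (Walk (Φ S) u w k)
  walk? u w zero = map′ (λ u≡w → subst (λ v → Walk (Φ S) u v 0) (element-≡ I {u} {w} u≡w) stop)
    (λ { stop → refl }) (proj₁ u Fin.≟ proj₁ w)
  walk? u w (suc k) = map′ (λ (_ , e , W) → step e W) (λ { (step e W) → _ , e , W })
    (anyElement? I λ v → nonZero? (multiplicity u v) ×-dec walk? v w k)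

  module _ (connected : Connected (Φ S)) where

    distance : ∀ u v → ∃[ d ] IsDistance (Φ S) u v d
    distance u v =
      let d , W , _ , min = least (walk? u v) (proj₂ (connected u v)) in d , W , min

    -- Comparing the computed distance with D is enough: any d offered by `BoundsDistances` is the
    -- length of a walk, so minimality puts the computed distance below it.
    boundsDistances? : ∀ D → Dec (BoundsDistances (Φ S) D)
    boundsDistances? D = map′
      (λ bound u v → let d , isDist = distance u v in d , isDist , bound u v)
      (λ bound u v → let _ , (_ , min) = distance u v
                         _ , (W , _) , d≤D = bound u v
                     in ≤-trans (min _ W) d≤D)
      (allElements? I λ u → allElements? I λ v → proj₁ (distance u v) ≤? D)

theorem4p7 : ∀ {n : ℕ} (S : SplitGraph n) → Connected (Φ S) →
    ∃[ D ] (IsDiameter (Φ S) D × D ≤ ⌈ deg S + 1 /2⌉)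
theorem4p7 S connected =
  let bounds = λ u v → let d , isDist = distance S connected u v in d , isDist , geodesic-length S isDist
      -- The diameter is the least bound on all distances, and `least` returns one not exceeding the
      -- bound it starts from.
      D , bD , D≤ , min = least (boundsDistances? S connected) bounds
  in D , (bD , min) , D≤
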